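{- Let $0\le k\le i<n-1$ be integers. The procedure untangle$(i,k)$ defines a bijection, and the procedure cliffify$(i,k)$ defines the inverse bijection, between on one hand the set of pairs $(B,D)\in\mathrm{Pathfam}(n)$ satisfying $$D_{i+1,k}=0\quad\text{and}\quad \sum_{j'=0}^{j-1}B_{i+1,j'}\le D_{i,k}+\sum_{j'=0}^{j-1}B_{i,j'}\quad\text{for } 0\le j\le k,$$ and on the other hand the set of pairs $(B,D)\in\mathrm{Pathfam}(n)$ satisfying $$\sum_{j'=0}^{j-1}B_{i+1,j'}\le\sum_{j'=0}^{j-1}B_{i,j'}\quad\text{for } 0\le j<k,\quad\text{and}\quad \sum_{j=0}^{k-1}B_{i+1,j}+D_{i+1,k}\le\sum_{j=0}^{k-1}B_{i,j}.$$ Here the relations $h_{i'}=i'-\sum_{j=0}^{k-1}B_{i',j}$ for $i'=i,i+1$ are assumed to hold initially in cliffify$(i,k)$, and they continue to hold after its execution.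
   Context: $\mathrm{Pathfam}(n)$ denotes the set of pairs $(B,D)$ of matrices indexed by $[n]\times[n]$, $[n]=\{0,1,\ldots,n-1\}$, where $B$ is strictly lower triangular with entries in $\{0,1\}$ and $D$ is weakly lower triangular with entries in $\mathbf{N}=\{0,1,2,\ldots\}$. The procedures modify $(B,D)$ in place ("$\gets$" is assignment; square brackets denote entries; $cur$ and $d$ are local integer variables). Procedure untangle$(i,k)$: set $cur\gets0$, $d\gets0$. For $j$ from $0$ up to $k-1$: set $cur\gets cur+B[i+1,j]-B[i,j]$; if $cur>d$ then set $d\gets cur$, $B[i,j]\gets1$, $B[i+1,j]\gets0$. After the loop set $D[i,k]\gets D[i,k]-d$ and $D[i+1,k]\gets d$. Procedure cliffify$(i,k)$, which also uses an auxiliary integer array $h$ (with entries written $h[i']$ or $h_{i'}$): set $d\gets D[i+1,k]$ and $cur\gets h[i+1]-h[i]-1$; set $D[i+1,k]\gets0$, $D[i,k]\gets D[i,k]+d$; set $h[i+1]\gets h[i+1]-d$, $h[i]\gets h[i]+d$. Then for $j$ from $k-1$ down to $0$: set $cur\gets cur+B[i+1,j]-B[i,j]$; if $cur<d$ then set $d\gets cur$, $B[i,j]\gets0$, $B[i+1,j]\gets1$. -}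

module Defs where

open import Level using (0ℓ)
open import Algebra.Properties.Monoid.Sum using (sum)
open import Data.Bool.Base using (if_then_else_)
open import Data.Fin.Base as Fin using (Fin; fromℕ; fromℕ<; inject₁; inject≤; toℕ)
open import Data.Integer.Base as ℤ using (ℤ; +_; 0ℤ; 1ℤ; _+_; _-_)
open import Data.Integer.Properties as ℤ using (_<?_; +-0-monoid)
open import Data.Nat.Base as ℕ using (ℕ; zero; suc)
open import Data.Nat.Properties as ℕ using (≤-trans; <-trans; <⇒≤; ≤-<-trans; n<1+n)
open import Data.Product.Base using (Σ; _×_; _,_; proj₁; proj₂)
open import Data.Sum.Base using (_⊎_)
open import Data.Vec.Base using (Vec; lookup; _[_]≔_; _[_]%=_)
open import Function.Base using (_∘_)
open import Relation.Binary.Bundles using (Setoid)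
import Relation.Binary.Construct.On as On
open import Relation.Binary.PropositionalEquality using (_≡_; setoid)
open import Relation.Nullary.Decidable using (does)
open import Relation.Unary using (Pred)

Matrix : ℕ → Set
Matrix n = Vec (Vec ℤ n) n

infix 9 _⟦_,_⟧
infixl 8 _⟦_,_⟧≔_

_⟦_,_⟧ : ∀ {n} → Matrix n → Fin n → Fin n → ℤ
M ⟦ r , c ⟧ = lookup (lookup M r) c

_⟦_,_⟧≔_ : ∀ {n} → Matrix n → Fin n → Fin n → ℤ → Matrix n
M ⟦ r , c ⟧≔ x = M [ r ]%= (λ row → row [ c ]≔ x)

-- The procedures act on arbitrary pairs of integer matrices, so that the
-- subtraction in untangle is not truncated; that their results have entries
-- in {0,1} and in ℕ is part of what membership in Pathfam asserts.
Matrices : ℕ → Set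
Matrices n = Matrix n × Matrix n

record Pathfam {n : ℕ} (BD : Matrices n) : Set where
  B = proj₁ BD
  D = proj₂ BD
  field
    B-strictlyLower : ∀ r c → r Fin.≤ c → B ⟦ r , c ⟧ ≡ 0ℤ
    B-binary        : ∀ r c → B ⟦ r , c ⟧ ≡ 0ℤ ⊎ B ⟦ r , c ⟧ ≡ 1ℤ
    D-weaklyLower   : ∀ r c → r Fin.< c → D ⟦ r , c ⟧ ≡ 0ℤ
    D-nonNegative   : ∀ r c → 0ℤ ℤ.≤ D ⟦ r , c ⟧

rowSum : ∀ {n} → Matrix n → Fin n → (j : ℕ) → .(j ℕ.≤ n) → ℤ
rowSum B r j j≤n = sum +-0-monoid {j} (λ j′ → B ⟦ r , inject≤ j′ j≤n ⟧)

-- Run the body for j = 0, 1, …, k-1.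
forUp : {S : Set} (k : ℕ) → (Fin k → S → S) → S → S
forUp zero    body s = s
forUp (suc k) body s = body (fromℕ k) (forUp k (body ∘ inject₁) s)

-- Run the body for j = k-1, …, 1, 0.
forDown : {S : Set} (k : ℕ) → (Fin k → S → S) → S → S
forDown zero    body s = s
forDown (suc k) body s = forDown k (body ∘ inject₁) (body (fromℕ k) s)

subsetSetoid : {A : Set} → Pred A 0ℓ → Setoid 0ℓ 0ℓ
subsetSetoid {A} P = On.setoid {B = Σ A P} (setoid A) proj₁

module Procedures (n i k : ℕ) (k≤i : k ℕ.≤ i) (1+i<n : suc i ℕ.< n) where

  i<n : i ℕ.< n
  i<n = <-trans (n<1+n i) 1+i<n

  k<n : k ℕ.< n
  k<n = ≤-<-trans k≤i i<n

  k≤n : k ℕ.≤ n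
  k≤n = <⇒≤ k<n

  rᵢ rᵢ₊₁ cₖ : Fin n
  rᵢ   = fromℕ< i<n
  rᵢ₊₁ = fromℕ< 1+i<n
  cₖ   = fromℕ< k<n

  -- The loop states are (B , cur , d).

  untangleStep : Fin k → Matrix n × ℤ × ℤ → Matrix n × ℤ × ℤ
  untangleStep j′ (B , cur₀ , d) =
    let j   = inject≤ j′ k≤n
        cur = cur₀ + B ⟦ rᵢ₊₁ , j ⟧ - B ⟦ rᵢ , j ⟧
    in if does (d <? cur)
       then (B ⟦ rᵢ , j ⟧≔ 1ℤ ⟦ rᵢ₊₁ , j ⟧≔ 0ℤ , cur , cur)
       else (B , cur , d)

  untangle : Matrices n → Matrices n
  untangle (B₀ , D₀) =
    let (B , _ , d) = forUp k untangleStep (B₀ , 0ℤ , 0ℤ)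
        D₁ = D₀ ⟦ rᵢ , cₖ ⟧≔ (D₀ ⟦ rᵢ , cₖ ⟧ - d)
        D₂ = D₁ ⟦ rᵢ₊₁ , cₖ ⟧≔ d
    in B , D₂

  cliffifyStep : Fin k → Matrix n × ℤ × ℤ → Matrix n × ℤ × ℤ
  cliffifyStep j′ (B , cur₀ , d) =
    let j   = inject≤ j′ k≤n
        cur = cur₀ + B ⟦ rᵢ₊₁ , j ⟧ - B ⟦ rᵢ , j ⟧
    in if does (cur <? d)
       then (B ⟦ rᵢ , j ⟧≔ 0ℤ ⟦ rᵢ₊₁ , j ⟧≔ 1ℤ , cur , cur)
       else (B , cur , d)

  cliffify : Matrices n → Vec ℤ n → Matrices n × Vec ℤ n
  cliffify (B₀ , D₀) h₀ =
    let d   = D₀ ⟦ rᵢ₊₁ , cₖ ⟧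
        cur = lookup h₀ rᵢ₊₁ - lookup h₀ rᵢ - 1ℤ
        D₁  = D₀ ⟦ rᵢ₊₁ , cₖ ⟧≔ 0ℤ
        D₂  = D₁ ⟦ rᵢ , cₖ ⟧≔ (D₁ ⟦ rᵢ , cₖ ⟧ + d)
        h₁  = h₀ [ rᵢ₊₁ ]≔ (lookup h₀ rᵢ₊₁ - d)
        h₂  = h₁ [ rᵢ ]≔ (lookup h₁ rᵢ + d)
        (B , _ , _) = forDown k cliffifyStep (B₀ , cur , d)
    in (B , D₂) , h₂

  record UntangleDomain (BD : Matrices n) : Set where
    B = proj₁ BD
    D = proj₂ BD
    field
      pathfam    : Pathfam BD
      D-zero     : D ⟦ rᵢ₊₁ , cₖ ⟧ ≡ 0ℤ
      sums-bound : ∀ j (j≤k : j ℕ.≤ k) → let j≤n = ≤-trans j≤k k≤n in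
                   rowSum B rᵢ₊₁ j j≤n ℤ.≤ D ⟦ rᵢ , cₖ ⟧ + rowSum B rᵢ j j≤n

  record CliffifyDomain (BD : Matrices n) : Set where
    B = proj₁ BD
    D = proj₂ BD
    field
      pathfam     : Pathfam BD
      sums-bound  : ∀ j (j<k : j ℕ.< k) → let j≤n = ≤-trans (<⇒≤ j<k) k≤n in
                    rowSum B rᵢ₊₁ j j≤n ℤ.≤ rowSum B rᵢ j j≤n
      final-bound : rowSum B rᵢ₊₁ k k≤n + D ⟦ rᵢ₊₁ , cₖ ⟧ ℤ.≤ rowSum B rᵢ k k≤n

  HeightAt : Matrices n → Vec ℤ n → Fin n → Set
  HeightAt (B , _) h r = lookup h r ≡ + toℕ r - rowSum B r k k≤n

  HeightRelations : Matrices n → Vec ℤ n → Set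
  HeightRelations BD h = HeightAt BD h rᵢ × HeightAt BD h rᵢ₊₁

{-# OPTIONS --safe #-}
module Submission where

-- Let c be the partial sum of B[i+1,·] − B[i,·].  Since c moves by at most one,
-- untangle exchanges the entries of a column exactly when c exceeds its running
-- maximum d, by one.  With cur = 2d − c the steps of cliffify undo those of
-- untangle, so both loops trace the same chain of states in opposite directions,
-- and the row-sum conditions are read off from invariants of such a chain.

open import Defs
open import Data.Bool.Base using (if_then_else_)
open import Data.Fin.Base as Fin using (Fin; fromℕ; fromℕ<; inject₁; inject≤; toℕ)
open import Data.Fin.Properties as Fin using (toℕ-injective; toℕ-fromℕ; toℕ-fromℕ<; toℕ-inject₁; toℕ-inject≤; toℕ<n)
open import Data.Integer.Base as ℤ using (ℤ; 0ℤ; 1ℤ; _+_; _-_)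
open import Data.Integer.Properties as ℤ using (_<?_; +-0-monoid)
open import Data.Integer.Tactic.RingSolver using (solve-∀)
open import Data.Nat.Base as ℕ using (ℕ; zero; suc; _≤_; _<_)
open import Data.Nat.Properties as ℕ using ()
open import Data.Product.Base using (Σ-syntax; ∃-syntax; _×_; _,_; proj₁; proj₂)
open import Data.Sum.Base using (_⊎_; inj₁; inj₂)
open import Data.Vec.Base using (Vec; lookup; tabulate; _[_]≔_)
open import Data.Vec.Properties using (lookup∘updateAt; lookup∘updateAt′; lookup∘update; lookup∘update′; lookup∘tabulate; updateAt-commutes)
open import Data.Vec.Relation.Binary.Pointwise.Extensional using (ext; Pointwise-≡⇒≡)
open import Algebra.Properties.Monoid.Sum +-0-monoid using (sum-cong-≗; sum-init-last)
open import Function.Base using (_∘_)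
open import Function.Bundles using (Inverse)
open import Relation.Binary.PropositionalEquality using (_≡_; _≢_; refl; sym; trans; cong; cong₂; subst; subst₂; module ≡-Reasoning)
open import Relation.Nullary using (yes; no; does; contradiction)
open import Relation.Nullary.Decidable using (dec-true; dec-false)

-- The value 2d - c is the row difference of the modified matrix. Each exchange moves one unit from
-- row i+1 to row i, so after d of them the partial sum of B[i,·] - B[i+1,·] has grown from -c to 2d
-- - c. The relations assumed for h make the initial cur of cliffify this same difference over k
-- columns. The two directions need different arguments at their ends. Untangle starts from d = 0,
-- whereas cliffify must be shown to arrive there: with no columns left cur is 0, and d = 0 follows
-- from 0 ≤ d ≤ cur. The final bound gives d ≤ cur at the outset, and the bounds for j < k keep d
-- nonnegative. In the other direction D[i,k] - d is nonnegative because d is the least nonnegative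
-- bound on the partial sums c.

≤-from-difference : ∀ {w x y z} → w ℤ.≤ x → x - w ≡ z - y → y ℤ.≤ z
≤-from-difference w≤x eq = ℤ.0≤i-j⇒j≤i (subst (0ℤ ℤ.≤_) eq (ℤ.i≤j⇒0≤j-i w≤x))

IsBit : ℤ → Set
IsBit x = x ≡ 0ℤ ⊎ x ≡ 1ℤ

-- An increment by a difference of bits can only overtake an upper bound that
-- is attained, and then exceeds it by exactly one.
overtake : ∀ {c d x y} → IsBit x → IsBit y → c ℤ.≤ d → d ℤ.< c + y - x →
           x ≡ 0ℤ × y ≡ 1ℤ × c ≡ d
overtake {c} {d} (inj₁ refl) (inj₁ refl) c≤d d<c′ =
  contradiction (ℤ.<-≤-trans d<c′ (ℤ.≤-trans (ℤ.≤-reflexive (eq c)) c≤d)) (ℤ.<-irrefl refl)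
  where eq : ∀ c → c + 0ℤ - 0ℤ ≡ c
        eq = solve-∀
overtake {c} {d} (inj₁ refl) (inj₂ refl) c≤d d<c′ =
  refl , refl , ℤ.≤-antisym c≤d (≤-from-difference (ℤ.i<j⇒suc[i]≤j d<c′) (eq c d 1ℤ))
  where eq : ∀ c d o → c + o - 0ℤ - (o + d) ≡ c - d
        eq = solve-∀
overtake {c} {d} (inj₂ refl) (inj₁ refl) c≤d d<c′ =
  contradiction
    (ℤ.<-≤-trans d<c′
      (ℤ.≤-trans (ℤ.i≤j⇒i-k≤j 1ℤ (ℤ.≤-reflexive (ℤ.+-identityʳ c))) c≤d))
    (ℤ.<-irrefl refl)
overtake {c} {d} (inj₂ refl) (inj₂ refl) c≤d d<c′ =
  contradiction (ℤ.<-≤-trans d<c′ (ℤ.≤-trans (ℤ.≤-reflexive (eq c 1ℤ)) c≤d)) (ℤ.<-irrefl refl)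
  where eq : ∀ c o → c + o - o ≡ c
        eq = solve-∀

-- Matrix updates, partial row sums and the two halves of `Pathfam`.

module _ {n : ℕ} where

  matrix-ext : {M N : Matrix n} → (∀ q c → M ⟦ q , c ⟧ ≡ N ⟦ q , c ⟧) → M ≡ N
  matrix-ext eq = Pointwise-≡⇒≡ (ext λ q → Pointwise-≡⇒≡ (ext (eq q)))

  set-same : ∀ (M : Matrix n) q c x → (M ⟦ q , c ⟧≔ x) ⟦ q , c ⟧ ≡ x
  set-same M q c x =
    trans (cong (λ row → lookup row c) (lookup∘updateAt q M)) (lookup∘update c (lookup M q) x)

  set-row : ∀ (M : Matrix n) {q q′} c c′ x → q′ ≢ q → (M ⟦ q , c ⟧≔ x) ⟦ q′ , c′ ⟧ ≡ M ⟦ q′ , c′ ⟧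
  set-row M {q} {q′} c c′ x q′≢q = cong (λ row → lookup row c′) (lookup∘updateAt′ q′ q q′≢q M)

  set-column : ∀ (M : Matrix n) q q′ {c c′} x → c′ ≢ c → (M ⟦ q , c ⟧≔ x) ⟦ q′ , c′ ⟧ ≡ M ⟦ q′ , c′ ⟧
  set-column M q q′ {c} {c′} x c′≢c with q′ Fin.≟ q
  ... | yes refl = trans (cong (λ row → lookup row c′) (lookup∘updateAt q M))
                         (lookup∘update′ c′≢c (lookup M q) x)
  ... | no q′≢q  = set-row M c c′ x q′≢q

  rowSum-cong : ∀ (B B′ : Matrix n) q m .(m≤n : m ≤ n) →
                (∀ c → toℕ c < m → B ⟦ q , c ⟧ ≡ B′ ⟦ q , c ⟧) →
                rowSum B q m m≤n ≡ rowSum B′ q m m≤n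
  rowSum-cong B B′ q m m≤n eq = sum-cong-≗ λ j →
    eq (inject≤ j m≤n) (subst (_< m) (sym (toℕ-inject≤ j m≤n)) (toℕ<n j))

  rowSum-suc : ∀ (B : Matrix n) q j .(j<n : j < n) (col : Fin n) → toℕ col ≡ j →
               rowSum B q (suc j) j<n ≡ rowSum B q j (ℕ.<⇒≤ j<n) + B ⟦ q , col ⟧
  rowSum-suc B q j j<n col col≡j =
    trans (sum-init-last (λ j′ → B ⟦ q , inject≤ j′ j<n ⟧))
      (cong₂ _+_
        (sum-cong-≗ λ j′ → cong (B ⟦ q ,_⟧) (toℕ-injective
          (trans (toℕ-inject≤ (inject₁ j′) j<n)
            (trans (toℕ-inject₁ j′) (sym (toℕ-inject≤ j′ (ℕ.<⇒≤ j<n)))))))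
        (cong (B ⟦ q ,_⟧) (toℕ-injective
          (trans (toℕ-inject≤ (fromℕ j) j<n) (trans (toℕ-fromℕ j) (sym col≡j))))))

  -- `Pathfam` is split in two because the loops change only `B` and the remaining assignments
  -- change only `D`.
  record ValidB (B : Matrix n) : Set where
    field
      strictlyLower : ∀ q c → q Fin.≤ c → B ⟦ q , c ⟧ ≡ 0ℤ
      binary        : ∀ q c → IsBit (B ⟦ q , c ⟧)

  record ValidD (D : Matrix n) : Set where
    field
      weaklyLower : ∀ q c → q Fin.< c → D ⟦ q , c ⟧ ≡ 0ℤ
      nonNegative : ∀ q c → 0ℤ ℤ.≤ D ⟦ q , c ⟧

  pathfam⇒B : ∀ {BD : Matrices n} → Pathfam BD → ValidB (proj₁ BD)
  pathfam⇒B p = record { strictlyLower = Pathfam.B-strictlyLower p ; binary = Pathfam.B-binary p }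

  pathfam⇒D : ∀ {BD : Matrices n} → Pathfam BD → ValidD (proj₂ BD)
  pathfam⇒D p = record { weaklyLower = Pathfam.D-weaklyLower p ; nonNegative = Pathfam.D-nonNegative p }

  valid⇒pathfam : ∀ {B D : Matrix n} → ValidB B → ValidD D → Pathfam (B , D)
  valid⇒pathfam b d = record
    { B-strictlyLower = ValidB.strictlyLower b
    ; B-binary        = ValidB.binary b
    ; D-weaklyLower   = ValidD.weaklyLower d
    ; D-nonNegative   = ValidD.nonNegative d
    }

-- Writing a pair of entries into one column of two fixed rows.

module TwoRows {n : ℕ} (r s : Fin n) (r≢s : r ≢ s) where

  write : Matrix n → Fin n → ℤ → ℤ → Matrix n
  write M col a b = M ⟦ r , col ⟧≔ a ⟦ s , col ⟧≔ b

  write-r : ∀ M col a b → write M col a b ⟦ r , col ⟧ ≡ a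
  write-r M col a b = trans (set-row (M ⟦ r , col ⟧≔ a) col col b r≢s) (set-same M r col a)

  write-s : ∀ M col a b → write M col a b ⟦ s , col ⟧ ≡ b
  write-s M col a b = set-same (M ⟦ r , col ⟧≔ a) s col b

  write-column : ∀ M col a b q {c} → c ≢ col → write M col a b ⟦ q , c ⟧ ≡ M ⟦ q , c ⟧
  write-column M col a b q c≢col = trans (set-column (M ⟦ r , col ⟧≔ a) s q b c≢col) (set-column M r q a c≢col)

  write-row : ∀ M col a b {q} c → q ≢ r → q ≢ s → write M col a b ⟦ q , c ⟧ ≡ M ⟦ q , c ⟧
  write-row M col a b c q≢r q≢s = trans (set-row (M ⟦ r , col ⟧≔ a) col c b q≢s) (set-row M col c a q≢r)

  -- The constructor `elsewhere` quantifies over the matrix and the written values, so a single case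
  -- split also serves a write on top of a write.
  data Cell (col : Fin n) : Fin n → Fin n → Set where
    at-r      : Cell col r col
    at-s      : Cell col s col
    elsewhere : ∀ {q c} → (∀ M a b → write M col a b ⟦ q , c ⟧ ≡ M ⟦ q , c ⟧) → Cell col q c

  cell : ∀ col q c → Cell col q c
  cell col q c with c Fin.≟ col | q Fin.≟ r | q Fin.≟ s
  ... | no c≢col | _        | _        = elsewhere λ M a b → write-column M col a b q c≢col
  ... | yes refl | yes refl | _        = at-r
  ... | yes refl | no _     | yes refl = at-s
  ... | yes refl | no q≢r   | no q≢s   = elsewhere λ M a b → write-row M col a b c q≢r q≢s

  write-restore : ∀ M col a b {x y} → M ⟦ r , col ⟧ ≡ x → M ⟦ s , col ⟧ ≡ y →
                  write (write M col a b) col x y ≡ M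
  write-restore M col a b {x} {y} x≡ y≡ = matrix-ext λ q c → go q c (cell col q c)
    where
    go : ∀ q c → Cell col q c → write (write M col a b) col x y ⟦ q , c ⟧ ≡ M ⟦ q , c ⟧
    go _ _ at-r            = trans (write-r (write M col a b) col x y) (sym x≡)
    go _ _ at-s            = trans (write-s (write M col a b) col x y) (sym y≡)
    go _ _ (elsewhere eq) = trans (eq (write M col a b) x y) (eq M a b)

  write-validB : ∀ {B} col {a b} → toℕ col < toℕ r → toℕ col < toℕ s → IsBit a → IsBit b →
                 ValidB B → ValidB (write B col a b)
  write-validB {B} col {a} {b} col<r col<s bit-a bit-b valid = record
    { strictlyLower = λ q c → lower q c (cell col q c)
    ; binary        = λ q c → bit q c (cell col q c)
    }
    where
    lower : ∀ q c → Cell col q c → q Fin.≤ c → write B col a b ⟦ q , c ⟧ ≡ 0ℤ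
    lower _ _ at-r            r≤col = contradiction r≤col (ℕ.<⇒≱ col<r)
    lower _ _ at-s            s≤col = contradiction s≤col (ℕ.<⇒≱ col<s)
    lower q c (elsewhere eq) q≤c   = trans (eq B a b) (ValidB.strictlyLower valid q c q≤c)
    bit : ∀ q c → Cell col q c → IsBit (write B col a b ⟦ q , c ⟧)
    bit _ _ at-r            = subst IsBit (sym (write-r B col a b)) bit-a
    bit _ _ at-s            = subst IsBit (sym (write-s B col a b)) bit-b
    bit q c (elsewhere eq) = subst IsBit (sym (eq B a b)) (ValidB.binary valid q c)

  -- Weak inequalities suffice here, unlike in `write-validB`, as `D` may be nonzero on the
  -- diagonal; the column k can equal the row i.
  write-validD : ∀ {D} col {a b} → toℕ col ≤ toℕ r → toℕ col ≤ toℕ s → 0ℤ ℤ.≤ a → 0ℤ ℤ.≤ b →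
                 ValidD D → ValidD (write D col a b)
  write-validD {D} col {a} {b} col≤r col≤s 0≤a 0≤b valid = record
    { weaklyLower = λ q c → lower q c (cell col q c)
    ; nonNegative = λ q c → nonNeg q c (cell col q c)
    }
    where
    lower : ∀ q c → Cell col q c → q Fin.< c → write D col a b ⟦ q , c ⟧ ≡ 0ℤ
    lower _ _ at-r            r<col = contradiction r<col (ℕ.≤⇒≯ col≤r)
    lower _ _ at-s            s<col = contradiction s<col (ℕ.≤⇒≯ col≤s)
    lower q c (elsewhere eq) q<c   = trans (eq D a b) (ValidD.weaklyLower valid q c q<c)
    nonNeg : ∀ q c → Cell col q c → 0ℤ ℤ.≤ write D col a b ⟦ q , c ⟧
    nonNeg _ _ at-r            = subst (0ℤ ℤ.≤_) (sym (write-r D col a b)) 0≤a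
    nonNeg _ _ at-s            = subst (0ℤ ℤ.≤_) (sym (write-s D col a b)) 0≤b
    nonNeg q c (elsewhere eq) = subst (0ℤ ℤ.≤_) (sym (eq D a b)) (ValidD.nonNegative valid q c)

  -- Single loop steps and their reversal.

  State : Set
  State = Matrix n × ℤ × ℤ

  advance : Matrix n → Fin n → ℤ → ℤ
  advance B col c = c + B ⟦ s , col ⟧ - B ⟦ r , col ⟧

  opaque
    -- The steps are opaque so that goals about loops mention a step itself and not its conditional;
    -- only the blocks that unfold it split on the comparison.
    stepUp : Fin n → State → State
    stepUp col (B , cur , d) =
      if does (d <? advance B col cur)
      then (write B col 1ℤ 0ℤ , advance B col cur , advance B col cur)
      else (B , advance B col cur , d)

    stepDown : Fin n → State → State
    stepDown col (B , cur , d) =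
      if does (advance B col cur <? d)
      then (write B col 0ℤ 1ℤ , advance B col cur , advance B col cur)
      else (B , advance B col cur , d)

  -- The change of variable cur ↦ 2d − cur turns the states of untangle into
  -- those of cliffify.
  reflect : State → State
  reflect (B , c , d) = B , d + (d - c) , d

  -- In `keep` the bound on `c′` decides the test of the upward step, and the bound on `c`, once
  -- reflected, that of the downward step. In `swap` the states are tied by equations because
  -- `stepDown-step` produces them only up to identities such as `reflect-self`.
  data Step (col : Fin n) : State → State → Set where
    keep : ∀ {B c c′ d} → c ℤ.≤ d → c′ ℤ.≤ d → c′ ≡ advance B col c →
           Step col (B , c , d) (B , c′ , d)
    swap : ∀ {B B′ c c′ d d′} → B ⟦ r , col ⟧ ≡ 0ℤ → B ⟦ s , col ⟧ ≡ 1ℤ →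
           B′ ≡ write B col 1ℤ 0ℤ → c ≡ d → c′ ≡ d′ → d′ ≡ d + 1ℤ →
           Step col (B , c , d) (B′ , c′ , d′)

  opaque
    unfolding stepUp stepDown

    stepUp-keep : ∀ col B c {c′ d} → advance B col c ≡ c′ → c′ ℤ.≤ d →
                  stepUp col (B , c , d) ≡ (B , c′ , d)
    stepUp-keep col B c {d = d} refl c′≤d rewrite dec-false (d <? _) (ℤ.≤⇒≯ c′≤d) = refl

    stepUp-swap : ∀ col B c {c′ d} → advance B col c ≡ c′ → d ℤ.< c′ →
                  stepUp col (B , c , d) ≡ (write B col 1ℤ 0ℤ , c′ , c′)
    stepUp-swap col B c {d = d} refl d<c′ rewrite dec-true (d <? _) d<c′ = refl

    stepDown-keep : ∀ col B e {e′ d} → advance B col e ≡ e′ → d ℤ.≤ e′ →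
                    stepDown col (B , e , d) ≡ (B , e′ , d)
    stepDown-keep col B e {d = d} refl d≤e′ rewrite dec-false (_ <? d) (ℤ.≤⇒≯ d≤e′) = refl

    stepDown-swap : ∀ col B e {e′ d} → advance B col e ≡ e′ → e′ ℤ.< d →
                    stepDown col (B , e , d) ≡ (write B col 0ℤ 1ℤ , e′ , e′)
    stepDown-swap col B e {d = d} refl e′<d rewrite dec-true (_ <? d) e′<d = refl

  i<i+1 : ∀ i → i ℤ.< i + 1ℤ
  i<i+1 i = ℤ.suc[i]≤j⇒i<j (ℤ.≤-reflexive (ℤ.+-comm 1ℤ i))

  ≤-reflect : ∀ {c d} → c ℤ.≤ d → d ℤ.≤ d + (d - c)
  ≤-reflect {c} {d} c≤d = ≤-from-difference c≤d (eq c d)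
    where eq : ∀ c d → d - c ≡ d + (d - c) - d
          eq = solve-∀

  reflect-≤ : ∀ {e d} → d ℤ.≤ e → d + (d - e) ℤ.≤ d
  reflect-≤ {e} {d} d≤e = ≤-from-difference d≤e (eq e d)
    where eq : ∀ e d → e - d ≡ d - (d + (d - e))
          eq = solve-∀

  reflect-self : ∀ d → d + (d - d) ≡ d
  reflect-self = solve-∀

  step⇒up : ∀ {col t u} → Step col t u → stepUp col t ≡ u
  step⇒up {col} (keep {B} {c} _ c′≤d c′≡) = stepUp-keep col B c (sym c′≡) c′≤d
  step⇒up {col} (swap {B} {d = d} x≡0 y≡1 refl refl refl refl) = stepUp-swap col B d
    (trans (cong₂ (λ x y → d + y - x) x≡0 y≡1) (ℤ.+-identityʳ (d + 1ℤ))) (i<i+1 d)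

  -- For a kept column, 2d - c′ plus the increment of `c` is 2d - c, which is at least d, so the
  -- test fails. After a swap both counters are d + 1 and the column holds 1 in row `r` and 0 in row
  -- `s`: the counter drops to d, the test succeeds, and the write restores the column.
  step⇒down : ∀ {col t u} → Step col t u → stepDown col (reflect u) ≡ reflect t
  step⇒down {col} (keep {B} {c} {d = d} c≤d _ refl) =
    stepDown-keep col B (d + (d - advance B col c)) {d + (d - c)} {d}
      (eq c d (B ⟦ s , col ⟧) (B ⟦ r , col ⟧)) (≤-reflect c≤d)
    where eq : ∀ c d y x → d + (d - (c + y - x)) + y - x ≡ d + (d - c)
          eq = solve-∀
  step⇒down {col} (swap {B} {d = d} x≡0 y≡1 refl refl refl refl) = trans
    (stepDown-swap col (write B col 1ℤ 0ℤ) ((d + 1ℤ) + ((d + 1ℤ) - (d + 1ℤ))) {d} {d + 1ℤ}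
      (trans (cong₂ (λ x y → (d + 1ℤ) + ((d + 1ℤ) - (d + 1ℤ)) + y - x)
                    (write-r B col 1ℤ 0ℤ) (write-s B col 1ℤ 0ℤ))
             (eq d 1ℤ))
      (i<i+1 d))
    (cong₂ (λ M e → M , e , d) (write-restore B col 1ℤ 0ℤ x≡0 y≡1) (sym (reflect-self d)))
    where
    eq : ∀ d o → (d + o) + ((d + o) - (d + o)) + 0ℤ - o ≡ d
    eq = solve-∀

  opaque
    unfolding stepUp stepDown

    stepUp-step : ∀ {col B c d} → ValidB B → c ℤ.≤ d →
                  Step col (B , c , d) (stepUp col (B , c , d))
    stepUp-step {col} {B} {c} {d} valid c≤d with d <? advance B col c
    ... | no  d≮c′ = keep c≤d (ℤ.≮⇒≥ d≮c′) refl
    ... | yes d<c′ with overtake (ValidB.binary valid r col) (ValidB.binary valid s col) c≤d d<c′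
    ...   | x≡0 , y≡1 , refl = swap x≡0 y≡1 refl refl refl
      (trans (cong₂ (λ x y → c + y - x) x≡0 y≡1) (ℤ.+-identityʳ (c + 1ℤ)))

    stepDown-step : ∀ {col B e d} → ValidB B → d ℤ.≤ e →
                    Step col (reflect (stepDown col (B , e , d))) (reflect (B , e , d))
    stepDown-step {col} {B} {e} {d} valid d≤e with advance B col e <? d
    ... | no  e′≮d = keep (reflect-≤ (ℤ.≮⇒≥ e′≮d)) (reflect-≤ d≤e)
                          (eq d e (B ⟦ s , col ⟧) (B ⟦ r , col ⟧))
      where eq : ∀ d e y x → d + (d - e) ≡ d + (d - (e + y - x)) + y - x
            eq = solve-∀
    ... | yes e′<d with overtake (ValidB.binary valid s col) (ValidB.binary valid r col) d≤e e<d+x-y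
      where
      eq : ∀ d e y x → d - (1ℤ + (e + y - x)) ≡ (d + x - y) - (1ℤ + e)
      eq = solve-∀
      -- Moving the increment across the inequality turns this into `overtake` with the two rows
      -- exchanged: now `e` is the bound and `d` the value that overtakes it, so the two must be
      -- equal.
      e<d+x-y : e ℤ.< d + B ⟦ r , col ⟧ - B ⟦ s , col ⟧
      e<d+x-y = ℤ.suc[i]≤j⇒i<j (≤-from-difference (ℤ.i<j⇒suc[i]≤j e′<d)
        (eq d e (B ⟦ s , col ⟧) (B ⟦ r , col ⟧)))
    ...   | y≡0 , x≡1 , refl =
      swap (write-r B col 0ℤ 1ℤ) (write-s B col 0ℤ 1ℤ)
        (sym (write-restore B col 0ℤ 1ℤ x≡1 y≡0)) (reflect-self (advance B col d)) (reflect-self d)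
        (trans (eq d 1ℤ) (cong₂ (λ x y → d + y - x + 1ℤ) (sym x≡1) (sym y≡0)))
      where
      eq : ∀ d o → d ≡ d + 0ℤ - o + o
      eq = solve-∀

  -- Chains of steps and the loops that traverse them.

  -- `forUp` and `forDown` recurse by precomposing the body with `inject₁`, so inductions over them
  -- need an arbitrary embedding that preserves column numbers.
  EmbedsColumns : ∀ {j} → (Fin j → Fin n) → Set
  EmbedsColumns emb = ∀ x → toℕ (emb x) ≡ toℕ x

  embeds-init : ∀ {j} {emb : Fin (suc j) → Fin n} → EmbedsColumns emb → EmbedsColumns (emb ∘ inject₁)
  embeds-init embeds x = trans (embeds (inject₁ x)) (toℕ-inject₁ x)

  embeds-last : ∀ {j} {emb : Fin (suc j) → Fin n} → EmbedsColumns emb → toℕ (emb (fromℕ j)) ≡ j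
  embeds-last {j} embeds = trans (embeds (fromℕ j)) (toℕ-fromℕ j)

  infixl 5 _▷_

  data Chain (A : Matrix n) : ℕ → State → Set where
    start : Chain A 0 (A , 0ℤ , 0ℤ)
    _▷_   : ∀ {j col t u} → Chain A j t → toℕ col ≡ j × Step col t u → Chain A (suc j) u

  chain⇒up : ∀ {A j u} → Chain A j u → (emb : Fin j → Fin n) → EmbedsColumns emb →
             forUp j (stepUp ∘ emb) (A , 0ℤ , 0ℤ) ≡ u
  chain⇒up start _ _ = refl
  chain⇒up (_▷_ {j} chain (col≡j , step)) emb embeds = trans
    (cong₂ stepUp
      (toℕ-injective (trans (embeds-last embeds) (sym col≡j)))
      (chain⇒up chain (emb ∘ inject₁) (embeds-init embeds)))
    (step⇒up step)

  chain⇒down : ∀ {A j u} → Chain A j u → (emb : Fin j → Fin n) → EmbedsColumns emb →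
               forDown j (stepDown ∘ emb) (reflect u) ≡ (A , 0ℤ , 0ℤ)
  chain⇒down start _ _ = refl
  chain⇒down (_▷_ {j} {u = u} chain (col≡j , step)) emb embeds = trans
    (cong (forDown j (stepDown ∘ emb ∘ inject₁)) (trans
      (cong (λ c → stepDown c (reflect u))
        (toℕ-injective (trans (embeds-last embeds) (sym col≡j))))
      (step⇒down step)))
    (chain⇒down chain (emb ∘ inject₁) (embeds-init embeds))

  write-before : ∀ M col a b q m .(m≤n : m ≤ n) → m ≤ toℕ col →
                 rowSum (write M col a b) q m m≤n ≡ rowSum M q m m≤n
  write-before M col a b q m m≤n m≤col = rowSum-cong (write M col a b) M q m m≤n λ c c<m →
    write-column M col a b q λ { refl → ℕ.<⇒≱ c<m m≤col }

  -- Invariants of a chain.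

  -- `A` is the matrix before untangling and `B` the current one. By `sums-s` and `sums-r`, `d` is
  -- the number of units moved from row `s` to row `r`; by `sums-A`, `c` is a partial sum difference
  -- of `A`. The `before` fields are strict in `m` since the case `m = j` follows from `c≤d`.
  record Invariant (A : Matrix n) (j : ℕ) (B : Matrix n) (c d : ℤ) : Set where
    field
      c≤d       : c ℤ.≤ d
      0≤d       : 0ℤ ℤ.≤ d
      untouched : ∀ q col → j ≤ toℕ col → A ⟦ q , col ⟧ ≡ B ⟦ q , col ⟧
      sums-s    : .(j≤n : j ≤ n) → rowSum A s j j≤n ≡ rowSum B s j j≤n + d
      sums-r    : .(j≤n : j ≤ n) → rowSum B r j j≤n ≡ rowSum A r j j≤n + d
      sums-A    : .(j≤n : j ≤ n) → rowSum A s j j≤n ≡ c + rowSum A r j j≤n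
      before-A  : ∀ m .(m≤n : m ≤ n) → m < j → rowSum A s m m≤n ℤ.≤ d + rowSum A r m m≤n
      before-B  : ∀ m .(m≤n : m ≤ n) → m < j → rowSum B s m m≤n ℤ.≤ rowSum B r m m≤n
      -- Minimality of `d` among nonnegative bounds; with `M` the entry D[i,k] it keeps D[i,k] - d
      -- nonnegative.
      least     : ∀ {M} → 0ℤ ℤ.≤ M →
                  (∀ m .(m≤n : m ≤ n) → m ≤ j → rowSum A s m m≤n ℤ.≤ M + rowSum A r m m≤n) →
                  .(j ≤ n) → d ℤ.≤ M

    now-A : .(j≤n : j ≤ n) → rowSum A s j j≤n ℤ.≤ d + rowSum A r j j≤n
    now-A j≤n = subst (ℤ._≤ d + rowSum A r j j≤n) (sym (sums-A j≤n)) (ℤ.+-monoˡ-≤ _ c≤d)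

    -- Moving `d` units between the rows turns each side of `now-A` into the matching side here. At
    -- `j = k` this is the final bound, `d` being the new entry D[i+1,k].
    now-B+d : .(j≤n : j ≤ n) → rowSum B s j j≤n + d ℤ.≤ rowSum B r j j≤n
    now-B+d j≤n = subst₂ ℤ._≤_ (sums-s j≤n) (trans (ℤ.+-comm d _) (sym (sums-r j≤n))) (now-A j≤n)

    now-B : .(j≤n : j ≤ n) → rowSum B s j j≤n ℤ.≤ rowSum B r j j≤n
    now-B j≤n = ℤ.≤-trans
      (subst (ℤ._≤ rowSum B s j j≤n + d) (ℤ.+-identityʳ _) (ℤ.+-monoʳ-≤ (rowSum B s j j≤n) 0≤d))
      (now-B+d j≤n)

    upto-A : ∀ m .(m≤n : m ≤ n) → m ≤ j → rowSum A s m m≤n ℤ.≤ d + rowSum A r m m≤n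
    upto-A m m≤n m≤j with ℕ.m≤n⇒m<n∨m≡n m≤j
    ... | inj₁ m<j  = before-A m m≤n m<j
    ... | inj₂ refl = now-A m≤n

    upto-B : ∀ m .(m≤n : m ≤ n) → m ≤ j → rowSum B s m m≤n ℤ.≤ rowSum B r m m≤n
    upto-B m m≤n m≤j with ℕ.m≤n⇒m<n∨m≡n m≤j
    ... | inj₁ m<j  = before-B m m≤n m<j
    ... | inj₂ refl = now-B m≤n

  invariant : ∀ {A j B c d} → Chain A j (B , c , d) → Invariant A j B c d
  invariant start = record
    { c≤d       = ℤ.≤-refl
    ; 0≤d       = ℤ.≤-refl
    ; untouched = λ _ _ _ → refl
    ; sums-s    = λ _ → refl
    ; sums-r    = λ _ → refl
    ; sums-A    = λ _ → refl
    ; before-A  = λ _ _ ()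
    ; before-B  = λ _ _ ()
    ; least     = λ 0≤M _ _ → 0≤M
    }
  invariant {A} (_▷_ {j} {col} chain (col≡j , keep {B} {c} {d = d} c≤d c′≤d refl)) = record
    { c≤d       = c′≤d
    ; 0≤d       = I.0≤d
    ; untouched = λ q col′ j<col′ → I.untouched q col′ (ℕ.<⇒≤ j<col′)
    ; sums-s    = λ j<n → begin
        rowSum A s (suc j) j<n                          ≡⟨ next-A s j<n ⟩
        rowSum A s j (ℕ.<⇒≤ j<n) + B ⟦ s , col ⟧        ≡⟨ cong (_+ B ⟦ s , col ⟧) (I.sums-s _) ⟩
        rowSum B s j (ℕ.<⇒≤ j<n) + d + B ⟦ s , col ⟧    ≡⟨ exchange (rowSum B s j (ℕ.<⇒≤ j<n)) d (B ⟦ s , col ⟧) ⟩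
        rowSum B s j (ℕ.<⇒≤ j<n) + B ⟦ s , col ⟧ + d    ≡⟨ cong (_+ d) (rowSum-suc B s j j<n col col≡j) ⟨
        rowSum B s (suc j) j<n + d                      ∎
    ; sums-r    = λ j<n → begin
        rowSum B r (suc j) j<n                          ≡⟨ rowSum-suc B r j j<n col col≡j ⟩
        rowSum B r j (ℕ.<⇒≤ j<n) + B ⟦ r , col ⟧        ≡⟨ cong (_+ B ⟦ r , col ⟧) (I.sums-r _) ⟩
        rowSum A r j (ℕ.<⇒≤ j<n) + d + B ⟦ r , col ⟧    ≡⟨ exchange (rowSum A r j (ℕ.<⇒≤ j<n)) d (B ⟦ r , col ⟧) ⟩
        rowSum A r j (ℕ.<⇒≤ j<n) + B ⟦ r , col ⟧ + d    ≡⟨ cong (_+ d) (next-A r j<n) ⟨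
        rowSum A r (suc j) j<n + d                      ∎
    ; sums-A    = λ j<n → begin
        rowSum A s (suc j) j<n                          ≡⟨ next-A s j<n ⟩
        rowSum A s j (ℕ.<⇒≤ j<n) + B ⟦ s , col ⟧        ≡⟨ cong (_+ B ⟦ s , col ⟧) (I.sums-A _) ⟩
        c + rowSum A r j (ℕ.<⇒≤ j<n) + B ⟦ s , col ⟧    ≡⟨ advanced c (rowSum A r j (ℕ.<⇒≤ j<n)) (B ⟦ s , col ⟧) (B ⟦ r , col ⟧) ⟩
        advance B col c + (rowSum A r j (ℕ.<⇒≤ j<n) + B ⟦ r , col ⟧) ≡⟨ cong (advance B col c +_) (next-A r j<n) ⟨
        advance B col c + rowSum A r (suc j) j<n        ∎
    ; before-A  = λ m m≤n m<1+j → I.upto-A m m≤n (ℕ.s≤s⁻¹ m<1+j)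
    ; before-B  = λ m m≤n m<1+j → I.upto-B m m≤n (ℕ.s≤s⁻¹ m<1+j)
    ; least     = λ 0≤M bound j<n → I.least 0≤M (λ m m≤n m≤j → bound m m≤n (ℕ.m≤n⇒m≤1+n m≤j)) (ℕ.<⇒≤ j<n)
    }
    where
    module I = Invariant (invariant chain)
    open ≡-Reasoning
    exchange : ∀ a b c → a + b + c ≡ a + c + b
    exchange = solve-∀
    advanced : ∀ c a y x → c + a + y ≡ c + y - x + (a + x)
    advanced = solve-∀
    next-A : ∀ q .(j<n : j < n) → rowSum A q (suc j) j<n ≡ rowSum A q j (ℕ.<⇒≤ j<n) + B ⟦ q , col ⟧
    next-A q j<n = trans (rowSum-suc A q j j<n col col≡j)
      (cong (rowSum A q j (ℕ.<⇒≤ j<n) +_) (I.untouched q col (ℕ.≤-reflexive (sym col≡j))))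
  invariant {A} (_▷_ {j} {col} chain (col≡j , swap {B} {d = d} x≡0 y≡1 refl refl refl refl)) = record
    { c≤d       = ℤ.≤-refl
    ; 0≤d       = ℤ.≤-trans I.0≤d d≤d+1
    ; untouched = λ q col′ j<col′ → trans (I.untouched q col′ (ℕ.<⇒≤ j<col′))
        (sym (write-column B col 1ℤ 0ℤ q λ { refl → ℕ.<-irrefl (sym col≡j) j<col′ }))
    ; sums-s    = λ j<n → begin
        rowSum A s (suc j) j<n                          ≡⟨ next-A s y≡1 j<n ⟩
        rowSum A s j (ℕ.<⇒≤ j<n) + 1ℤ                   ≡⟨ cong (_+ 1ℤ) (I.sums-s _) ⟩
        rowSum B s j (ℕ.<⇒≤ j<n) + d + 1ℤ               ≡⟨ regroup₀ (rowSum B s j (ℕ.<⇒≤ j<n)) d 1ℤ ⟩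
        rowSum B s j (ℕ.<⇒≤ j<n) + 0ℤ + (d + 1ℤ)        ≡⟨ cong (_+ (d + 1ℤ)) (next-B s (write-s B col 1ℤ 0ℤ) j<n) ⟨
        rowSum B′ s (suc j) j<n + (d + 1ℤ)              ∎
    ; sums-r    = λ j<n → begin
        rowSum B′ r (suc j) j<n                         ≡⟨ next-B r (write-r B col 1ℤ 0ℤ) j<n ⟩
        rowSum B r j (ℕ.<⇒≤ j<n) + 1ℤ                   ≡⟨ cong (_+ 1ℤ) (I.sums-r _) ⟩
        rowSum A r j (ℕ.<⇒≤ j<n) + d + 1ℤ               ≡⟨ regroup₀ (rowSum A r j (ℕ.<⇒≤ j<n)) d 1ℤ ⟩
        rowSum A r j (ℕ.<⇒≤ j<n) + 0ℤ + (d + 1ℤ)        ≡⟨ cong (_+ (d + 1ℤ)) (next-A r x≡0 j<n) ⟨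
        rowSum A r (suc j) j<n + (d + 1ℤ)               ∎
    ; sums-A    = sums-A′
    ; before-A  = λ m m≤n m<1+j → ℤ.≤-trans (I.upto-A m m≤n (ℕ.s≤s⁻¹ m<1+j)) (ℤ.+-monoˡ-≤ _ d≤d+1)
    ; before-B  = λ m m≤n m<1+j → subst₂ ℤ._≤_ (sym (old m m≤n m<1+j s)) (sym (old m m≤n m<1+j r))
        (I.upto-B m m≤n (ℕ.s≤s⁻¹ m<1+j))
    -- Right after a swap the maximum is attained, so the bound for `suc j` columns alone forces
    -- `d + 1ℤ ≤ M`.
    ; least     = λ {M} 0≤M bound j<n → ≤-from-difference
        (subst (ℤ._≤ M + rowSum A r (suc j) j<n) (sums-A′ j<n) (bound (suc j) j<n ℕ.≤-refl))
        (cancel M (rowSum A r (suc j) j<n) (d + 1ℤ))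
    }
    where
    module I = Invariant (invariant chain)
    open ≡-Reasoning
    B′ = write B col 1ℤ 0ℤ
    d≤d+1 : d ℤ.≤ d + 1ℤ
    d≤d+1 = ℤ.<⇒≤ (i<i+1 d)
    regroup₀ : ∀ a d o → a + d + o ≡ a + 0ℤ + (d + o)
    regroup₀ = solve-∀
    regroup₁ : ∀ a d o → d + a + o ≡ d + o + (a + 0ℤ)
    regroup₁ = solve-∀
    cancel : ∀ M a d → M + a - (d + a) ≡ M - d
    cancel = solve-∀
    old : ∀ m .(m≤n : m ≤ n) → m < suc j → ∀ q → rowSum B′ q m m≤n ≡ rowSum B q m m≤n
    old m m≤n m<1+j q = write-before B col 1ℤ 0ℤ q m m≤n (subst (m ≤_) (sym col≡j) (ℕ.s≤s⁻¹ m<1+j))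
    next-A : ∀ q {x} → B ⟦ q , col ⟧ ≡ x → .(j<n : j < n) →
             rowSum A q (suc j) j<n ≡ rowSum A q j (ℕ.<⇒≤ j<n) + x
    next-A q x≡ j<n = trans (rowSum-suc A q j j<n col col≡j)
      (cong (rowSum A q j (ℕ.<⇒≤ j<n) +_)
        (trans (I.untouched q col (ℕ.≤-reflexive (sym col≡j))) x≡))
    next-B : ∀ q {x} → B′ ⟦ q , col ⟧ ≡ x → .(j<n : j < n) →
             rowSum B′ q (suc j) j<n ≡ rowSum B q j (ℕ.<⇒≤ j<n) + x
    next-B q x≡ j<n = trans (rowSum-suc B′ q j j<n col col≡j)
      (cong₂ _+_ (old j (ℕ.<⇒≤ j<n) ℕ.≤-refl q) x≡)
    sums-A′ : .(j<n : j < n) → rowSum A s (suc j) j<n ≡ d + 1ℤ + rowSum A r (suc j) j<n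
    sums-A′ j<n = begin
      rowSum A s (suc j) j<n                          ≡⟨ next-A s y≡1 j<n ⟩
      rowSum A s j (ℕ.<⇒≤ j<n) + 1ℤ                   ≡⟨ cong (_+ 1ℤ) (I.sums-A _) ⟩
      d + rowSum A r j (ℕ.<⇒≤ j<n) + 1ℤ               ≡⟨ regroup₁ (rowSum A r j (ℕ.<⇒≤ j<n)) d 1ℤ ⟩
      d + 1ℤ + (rowSum A r j (ℕ.<⇒≤ j<n) + 0ℤ)        ≡⟨ cong (d + 1ℤ +_) (next-A r x≡0 j<n) ⟨
      d + 1ℤ + rowSum A r (suc j) j<n                 ∎

  -- Building a chain from either end.

  opaque
    unfolding stepUp

    stepUp-validB : ∀ {col} t → toℕ col < toℕ r → toℕ col < toℕ s →
                    ValidB (proj₁ t) → ValidB (proj₁ (stepUp col t))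
    stepUp-validB {col} (B , c , d) col<r col<s valid with d <? advance B col c
    ... | no  _ = valid
    ... | yes _ = write-validB col col<r col<s (inj₂ refl) (inj₁ refl) valid

  -- Each new link requires `c ≤ d`, which is read off from the invariant of the chain built so far.
  chainUp : ∀ {A} j (emb : Fin j → Fin n) → EmbedsColumns emb →
            j ≤ toℕ r → j ≤ toℕ s → ValidB A →
            let u = forUp j (stepUp ∘ emb) (A , 0ℤ , 0ℤ) in Chain A j u × ValidB (proj₁ u)
  chainUp zero    emb embeds _ _ valid = start , valid
  chainUp (suc j) emb embeds j<r j<s valid
    with chain , valid′ ← chainUp j (emb ∘ inject₁) (embeds-init embeds)
                                  (ℕ.<⇒≤ j<r) (ℕ.<⇒≤ j<s) valid
    = chain ▷ (col≡j , stepUp-step valid′ (Invariant.c≤d (invariant chain)))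
    , stepUp-validB (forUp j (stepUp ∘ emb ∘ inject₁) (_ , 0ℤ , 0ℤ)) (subst (_< toℕ r) (sym col≡j) j<r) (subst (_< toℕ s) (sym col≡j) j<s) valid′
    where
    col≡j : toℕ (emb (fromℕ j)) ≡ j
    col≡j = embeds-last embeds

  -- What is known on the way down, before the original matrix `A` exists: `height` says that `e` is
  -- the difference of the row sums over the columns still to be visited.
  record DownReady (j : ℕ) .(j≤n : j ≤ n) (t : State) : Set where
    B = proj₁ t
    e = proj₁ (proj₂ t)
    d = proj₂ (proj₂ t)
    field
      valid  : ValidB B
      height : e + rowSum B s j j≤n ≡ rowSum B r j j≤n
      bounds : ∀ m .(m≤n : m ≤ n) → m < j → rowSum B s m m≤n ℤ.≤ rowSum B r m m≤n
      0≤d    : 0ℤ ℤ.≤ d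
      d≤e    : d ℤ.≤ e

  height-advance : ∀ {j col} B e .(j<n : j < n) → toℕ col ≡ j →
                   e + rowSum B s (suc j) j<n ≡ rowSum B r (suc j) j<n →
                   advance B col e + rowSum B s j (ℕ.<⇒≤ j<n) ≡ rowSum B r j (ℕ.<⇒≤ j<n)
  height-advance {j} {col} B e j<n col≡j height = begin
    advance B col e + a      ≡⟨ collect e a y x ⟩
    e + (a + y) - x          ≡⟨ cong (λ z → e + z - x) (rowSum-suc B s j j<n col col≡j) ⟨
    e + rowSum B s (suc j) j<n - x ≡⟨ cong (_- x) height ⟩
    rowSum B r (suc j) j<n - x     ≡⟨ cong (_- x) (rowSum-suc B r j j<n col col≡j) ⟩
    b + x - x                ≡⟨ cancel b x ⟩
    b                        ∎
    where
    open ≡-Reasoning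
    a = rowSum B s j (ℕ.<⇒≤ j<n)
    b = rowSum B r j (ℕ.<⇒≤ j<n)
    x = B ⟦ r , col ⟧
    y = B ⟦ s , col ⟧
    collect : ∀ e a y x → e + y - x + a ≡ e + (a + y) - x
    collect = solve-∀
    cancel : ∀ b x → b + x - x ≡ b
    cancel = solve-∀

  opaque
    unfolding stepDown

    stepDown-ready : ∀ {j col t} .(j<n : j < n) → toℕ col ≡ j → toℕ col < toℕ r → toℕ col < toℕ s →
                     DownReady (suc j) j<n t → DownReady j (ℕ.<⇒≤ j<n) (stepDown col t)
    stepDown-ready {j} {col} {B , e , d} j<n col≡j col<r col<s ready with advance B col e <? d
    ... | no  e′≮d = record
      { valid  = R.valid
      ; height = height-advance B e j<n col≡j R.height
      ; bounds = λ m m≤n m<j → R.bounds m m≤n (ℕ.m<n⇒m<1+n m<j)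
      ; 0≤d    = R.0≤d
      ; d≤e    = ℤ.≮⇒≥ e′≮d
      }
      where module R = DownReady ready
    ... | yes _ = record
      { valid  = write-validB col col<r col<s (inj₁ refl) (inj₂ refl) R.valid
      ; height = subst₂ (λ a b → advance B col e + a ≡ b) (old j (ℕ.<⇒≤ j<n) ℕ.≤-refl s) (old j (ℕ.<⇒≤ j<n) ℕ.≤-refl r) height′
      ; bounds = λ m m≤n m<j → subst₂ ℤ._≤_ (old m m≤n (ℕ.<⇒≤ m<j) s) (old m m≤n (ℕ.<⇒≤ m<j) r)
          (R.bounds m m≤n (ℕ.m<n⇒m<1+n m<j))
      -- The new `d` is the row sum difference over the first `j` columns, so the bound at `m = j`
      -- makes it nonnegative.
      ; 0≤d    = ≤-from-difference (R.bounds j (ℕ.<⇒≤ j<n) ℕ.≤-refl)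
          (trans (cong (_- rowSum B s j (ℕ.<⇒≤ j<n)) (sym height′)) (cancel (advance B col e) (rowSum B s j (ℕ.<⇒≤ j<n))))
      ; d≤e    = ℤ.≤-refl
      }
      where
      module R = DownReady ready
      height′ : advance B col e + rowSum B s j (ℕ.<⇒≤ j<n) ≡ rowSum B r j (ℕ.<⇒≤ j<n)
      height′ = height-advance B e j<n col≡j R.height
      old : ∀ m .(m≤n : m ≤ n) → m ≤ j → ∀ q →
            rowSum B q m m≤n ≡ rowSum (write B col 0ℤ 1ℤ) q m m≤n
      old m m≤n m≤j q = sym (write-before B col 0ℤ 1ℤ q m m≤n (subst (m ≤_) (sym col≡j) m≤j))
      cancel : ∀ e a → e + a - a ≡ e - 0ℤ
      cancel = solve-∀

  -- The matrix `A` is whatever the loop leaves behind. The recursive call runs the rest of the loop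
  -- and yields the earlier links; the step just executed becomes the last link.
  chainDown : ∀ {t} j (emb : Fin j → Fin n) → EmbedsColumns emb →
              .(j≤n : j ≤ n) → j ≤ toℕ r → j ≤ toℕ s → DownReady j j≤n t →
              ∃[ A ] ValidB A × forDown j (stepDown ∘ emb) t ≡ (A , 0ℤ , 0ℤ) × Chain A j (reflect t)
  chainDown {B , e , d} zero emb embeds j≤n _ _ ready
    -- Empty row sums give `e = 0`, and then `0 ≤ d ≤ e` gives `d = 0`, so the reflected state is
    -- the one of `start`.
    with refl ← trans (sym (ℤ.+-identityʳ e)) (DownReady.height ready)
    with refl ← ℤ.≤-antisym (DownReady.d≤e ready) (DownReady.0≤d ready)
    = B , DownReady.valid ready , refl , start
  chainDown (suc j) emb embeds j<n j<r j<s ready =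
    let col≡j = embeds-last embeds
        A , valid , runs , chain =
          chainDown j (emb ∘ inject₁) (embeds-init embeds) (ℕ.<⇒≤ j<n) (ℕ.<⇒≤ j<r) (ℕ.<⇒≤ j<s)
            (stepDown-ready j<n col≡j (subst (_< toℕ r) (sym col≡j) j<r)
                                      (subst (_< toℕ s) (sym col≡j) j<s) ready)
    in A , valid , runs , chain ▷ (col≡j , stepDown-step (DownReady.valid ready) (DownReady.d≤e ready))

  write-commute : ∀ M col a b → M ⟦ s , col ⟧≔ b ⟦ r , col ⟧≔ a ≡ write M col a b
  write-commute M col a b = updateAt-commutes r s r≢s M

-- The two procedures on their domains.

module _ (n i k : ℕ) (k≤i : k ≤ i) (1+i<n : suc i < n) where

  open Procedures n i k k≤i 1+i<n

  private
    toℕ-rᵢ : toℕ rᵢ ≡ i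
    toℕ-rᵢ = toℕ-fromℕ< i<n

    toℕ-rᵢ₊₁ : toℕ rᵢ₊₁ ≡ suc i
    toℕ-rᵢ₊₁ = toℕ-fromℕ< 1+i<n

    rᵢ≢rᵢ₊₁ : rᵢ ≢ rᵢ₊₁
    rᵢ≢rᵢ₊₁ eq = ℕ.1+n≢n (trans (sym toℕ-rᵢ₊₁) (trans (cong toℕ (sym eq)) toℕ-rᵢ))

    k≤rᵢ : k ≤ toℕ rᵢ
    k≤rᵢ = subst (k ≤_) (sym toℕ-rᵢ) k≤i

    k≤rᵢ₊₁ : k ≤ toℕ rᵢ₊₁
    k≤rᵢ₊₁ = subst (k ≤_) (sym toℕ-rᵢ₊₁) (ℕ.m≤n⇒m≤1+n k≤i)

    cₖ≤ : ∀ {q : Fin n} → k ≤ toℕ q → toℕ cₖ ≤ toℕ q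
    cₖ≤ {q} = subst (_≤ toℕ q) (sym (toℕ-fromℕ< k<n))

    column : Fin k → Fin n
    column j = inject≤ j k≤n

    toℕ-column : ∀ j → toℕ (column j) ≡ toℕ j
    toℕ-column j = toℕ-inject≤ j k≤n

  open TwoRows rᵢ rᵢ₊₁ rᵢ≢rᵢ₊₁

  opaque
    unfolding stepUp stepDown

    untangleStep≡ : untangleStep ≡ stepUp ∘ column
    untangleStep≡ = refl

    cliffifyStep≡ : cliffifyStep ≡ stepDown ∘ column
    cliffifyStep≡ = refl

  untangle-chain : ∀ {A} → ValidB A →
                   let u = forUp k untangleStep (A , 0ℤ , 0ℤ) in Chain A k u × ValidB (proj₁ u)
  untangle-chain {A} valid =
    subst (λ step → let u = forUp k step (A , 0ℤ , 0ℤ) in Chain A k u × ValidB (proj₁ u))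
      (sym untangleStep≡) (chainUp k column toℕ-column k≤rᵢ k≤rᵢ₊₁ valid)

  -- With ρ and σ the row sums of rows i and i+1, the initial cur is (i + 1 - σ) - (i - ρ) - 1 = ρ -
  -- σ. The value `e` is pinned down only by an equation, so that it can be taken as `d + (d - c)`
  -- after untangle and as `ρ - σ` for an arbitrary input.
  cliffify-unfold : ∀ B D h {e} → HeightRelations (B , D) h →
                    e + rowSum B rᵢ₊₁ k k≤n ≡ rowSum B rᵢ k k≤n →
                    proj₁ (cliffify (B , D) h) ≡
                      ( proj₁ (forDown k (stepDown ∘ column) (B , e , D ⟦ rᵢ₊₁ , cₖ ⟧))
                      , write D cₖ (D ⟦ rᵢ , cₖ ⟧ + D ⟦ rᵢ₊₁ , cₖ ⟧) 0ℤ )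
  cliffify-unfold B D h {e} (hᵢ , hᵢ₊₁) height = cong₂ _,_
    (cong₂ (λ step x → proj₁ (forDown k step (B , x , D ⟦ rᵢ₊₁ , cₖ ⟧))) cliffifyStep≡ initial)
    (trans (write-commute D cₖ _ 0ℤ)
           (cong (λ x → write D cₖ (x + D ⟦ rᵢ₊₁ , cₖ ⟧) 0ℤ) (set-row D cₖ cₖ 0ℤ rᵢ≢rᵢ₊₁)))
    where
    open ≡-Reasoning
    σ = rowSum B rᵢ₊₁ k k≤n
    collect : ∀ o m σ e → (o + m - σ) - (m - (e + σ)) - o ≡ e
    collect = solve-∀
    initial : lookup h rᵢ₊₁ - lookup h rᵢ - 1ℤ ≡ e
    initial = begin
      lookup h rᵢ₊₁ - lookup h rᵢ - 1ℤ
        ≡⟨ cong₂ (λ x y → x - y - 1ℤ)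
             (trans hᵢ₊₁ (cong (λ m → ℤ.+ m - σ) toℕ-rᵢ₊₁))
             (trans hᵢ (cong₂ (λ m x → ℤ.+ m - x) toℕ-rᵢ (sym height))) ⟩
      (1ℤ + ℤ.+ i - σ) - (ℤ.+ i - (e + σ)) - 1ℤ
        ≡⟨ collect 1ℤ (ℤ.+ i) σ e ⟩
      e ∎

  untangle-maps : ∀ BD → UntangleDomain BD → CliffifyDomain (untangle BD)
  untangle-maps (A , D) dom = record
    { pathfam     = valid⇒pathfam valid (write-validD cₖ (cₖ≤ k≤rᵢ) (cₖ≤ k≤rᵢ₊₁)
        -- The domain condition says that D[i,k] bounds all partial sum differences, hence it is at
        -- least their least bound `d`.
        (ℤ.i≤j⇒0≤j-i (I.least (ValidD.nonNegative validD rᵢ cₖ)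
          (λ m m≤n m≤k → U.sums-bound m m≤k) k≤n))
        I.0≤d validD)
    ; sums-bound  = λ j j<k → I.before-B j _ j<k
    ; final-bound = subst (λ x → rowSum B rᵢ₊₁ k k≤n + x ℤ.≤ rowSum B rᵢ k k≤n)
        (sym (write-s D cₖ _ d)) (I.now-B+d k≤n)
    }
    where
    module U = UntangleDomain dom
    validD = pathfam⇒D U.pathfam
    run    = untangle-chain (pathfam⇒B U.pathfam)
    valid  = proj₂ run
    B = proj₁ (forUp k untangleStep (A , 0ℤ , 0ℤ))
    d = proj₂ (proj₂ (forUp k untangleStep (A , 0ℤ , 0ℤ)))
    module I = Invariant (invariant (proj₁ run))

  cliffify-untangle : ∀ BD → UntangleDomain BD → ∀ h → HeightRelations (untangle BD) h →
                      proj₁ (cliffify (untangle BD) h) ≡ BD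
  cliffify-untangle (A , D) dom h heights = begin
    proj₁ (cliffify (B , D′) h)
      ≡⟨ cliffify-unfold B D′ h heights height ⟩
    ( proj₁ (forDown k (stepDown ∘ column) (B , d + (d - c) , D′ ⟦ rᵢ₊₁ , cₖ ⟧))
    , write D′ cₖ (D′ ⟦ rᵢ , cₖ ⟧ + D′ ⟦ rᵢ₊₁ , cₖ ⟧) 0ℤ )
      ≡⟨ cong₂ (λ x y → proj₁ (forDown k (stepDown ∘ column) (B , d + (d - c) , y)) , write D′ cₖ (x + y) 0ℤ)
           (write-r D cₖ _ d) (write-s D cₖ _ d) ⟩
    ( proj₁ (forDown k (stepDown ∘ column) (B , d + (d - c) , d))
    , write D′ cₖ (D ⟦ rᵢ , cₖ ⟧ - d + d) 0ℤ )
      ≡⟨ cong₂ _,_ (cong proj₁ (chain⇒down chain column toℕ-column))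
           (write-restore D cₖ _ d (cancel (D ⟦ rᵢ , cₖ ⟧) d) U.D-zero) ⟩
    (A , D) ∎
    where
    open ≡-Reasoning
    module U = UntangleDomain dom
    chain = proj₁ (untangle-chain (pathfam⇒B U.pathfam))
    B = proj₁ (forUp k untangleStep (A , 0ℤ , 0ℤ))
    c = proj₁ (proj₂ (forUp k untangleStep (A , 0ℤ , 0ℤ)))
    d = proj₂ (proj₂ (forUp k untangleStep (A , 0ℤ , 0ℤ)))
    D′ = write D cₖ (D ⟦ rᵢ , cₖ ⟧ - d) d
    module I = Invariant (invariant chain)
    cancel : ∀ x d → x ≡ x - d + d
    cancel = solve-∀
    σ = rowSum B rᵢ₊₁ k k≤n
    ρ = rowSum A rᵢ k k≤n
    rearrange : ∀ d c σ → d + (d - c) + σ ≡ σ + d - c + d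
    rearrange = solve-∀
    cancel′ : ∀ c ρ d → c + ρ - c + d ≡ ρ + d
    cancel′ = solve-∀
    -- This places the start of cliffify at the reflection of the last state of untangle.
    height : d + (d - c) + rowSum B rᵢ₊₁ k k≤n ≡ rowSum B rᵢ k k≤n
    height = begin
      d + (d - c) + σ                    ≡⟨ rearrange d c σ ⟩
      σ + d - c + d                      ≡⟨ cong (λ x → x - c + d) (I.sums-s k≤n) ⟨
      rowSum A rᵢ₊₁ k k≤n - c + d        ≡⟨ cong (λ x → x - c + d) (I.sums-A k≤n) ⟩
      c + ρ - c + d                      ≡⟨ cancel′ c ρ d ⟩
      ρ + d                              ≡⟨ I.sums-r k≤n ⟨
      rowSum B rᵢ k k≤n                  ∎

  -- In `computes` the matrix `A` is fixed before `h` is chosen, so all admissible height vectors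
  -- give the same output; this later allows `heightVector` to be replaced by any other.
  record Cliffified (BD : Matrices n) : Set where
    B = proj₁ BD
    D = proj₂ BD
    d = D ⟦ rᵢ₊₁ , cₖ ⟧
    D′ = write D cₖ (D ⟦ rᵢ , cₖ ⟧ + d) 0ℤ
    field
      A         : Matrix n
      cur       : ℤ
      chain     : Chain A k (B , cur , d)
      valid     : ValidB A
      computes  : ∀ h → HeightRelations BD h → proj₁ (cliffify BD h) ≡ (A , D′)

  cliffified : ∀ BD → CliffifyDomain BD → Cliffified BD
  cliffified (B , D) dom = record
    { A        = proj₁ run
    ; cur      = _
    ; chain    = proj₂ (proj₂ (proj₂ run))
    ; valid    = proj₁ (proj₂ run)
    ; computes = λ h heights → trans (cliffify-unfold B D h heights (cancel ρ σ))
        (cong (λ t → proj₁ t , _) (proj₁ (proj₂ (proj₂ run))))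
    }
    where
    module C = CliffifyDomain dom
    d = D ⟦ rᵢ₊₁ , cₖ ⟧
    ρ = rowSum B rᵢ k k≤n
    σ = rowSum B rᵢ₊₁ k k≤n
    cancel : ∀ ρ σ → ρ - σ + σ ≡ ρ
    cancel = solve-∀
    regroup : ∀ ρ σ d → ρ - (σ + d) ≡ ρ - σ - d
    regroup = solve-∀
    ready : DownReady k k≤n (B , ρ - σ , d)
    ready = record
      { valid  = pathfam⇒B C.pathfam
      ; height = cancel ρ σ
      ; bounds = λ m m≤n m<k → C.sums-bound m m<k
      ; 0≤d    = Pathfam.D-nonNegative C.pathfam rᵢ₊₁ cₖ
      ; d≤e    = ≤-from-difference C.final-bound (regroup ρ σ d)
      }
    run = chainDown k column toℕ-column k≤n k≤rᵢ k≤rᵢ₊₁ ready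

  cliffify-maps : ∀ BD → CliffifyDomain BD → ∀ h → HeightRelations BD h →
                  UntangleDomain (proj₁ (cliffify BD h))
  cliffify-maps (B , D) dom h heights = subst UntangleDomain (sym (X.computes h heights)) (record
    { pathfam    = valid⇒pathfam X.valid (write-validD cₖ (cₖ≤ k≤rᵢ) (cₖ≤ k≤rᵢ₊₁)
        (ℤ.+-mono-≤ (ValidD.nonNegative validD rᵢ cₖ) I.0≤d) ℤ.≤-refl validD)
    ; D-zero     = write-s D cₖ _ 0ℤ
    -- The invariant bounds the differences by `d`, and the new D[i,k] is `d` plus a nonnegative
    -- entry.
    ; sums-bound = λ j j≤k → ℤ.≤-trans (I.upto-A j _ j≤k)
        (ℤ.+-monoˡ-≤ _ (ℤ.≤-trans d≤D+d (ℤ.≤-reflexive (sym (write-r D cₖ _ 0ℤ)))))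
    })
    where
    module X = Cliffified (cliffified (B , D) dom)
    module I = Invariant (invariant X.chain)
    validD = pathfam⇒D (CliffifyDomain.pathfam dom)
    d = D ⟦ rᵢ₊₁ , cₖ ⟧
    d≤D+d : d ℤ.≤ D ⟦ rᵢ , cₖ ⟧ + d
    d≤D+d = subst (ℤ._≤ D ⟦ rᵢ , cₖ ⟧ + d) (ℤ.+-identityˡ d)
      (ℤ.+-monoˡ-≤ d (ValidD.nonNegative validD rᵢ cₖ))

  untangle-cliffify : ∀ BD → CliffifyDomain BD → ∀ h → HeightRelations BD h →
                      untangle (proj₁ (cliffify BD h)) ≡ BD
  untangle-cliffify (B , D) dom h heights = begin
    untangle (proj₁ (cliffify (B , D) h))
      ≡⟨ cong untangle (X.computes h heights) ⟩
    untangle (X.A , X.D′)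
      ≡⟨ cong (λ t → proj₁ t , write X.D′ cₖ (X.D′ ⟦ rᵢ , cₖ ⟧ - proj₂ (proj₂ t)) (proj₂ (proj₂ t)))
           (trans (cong (λ step → forUp k step (X.A , 0ℤ , 0ℤ)) untangleStep≡)
                  (chain⇒up X.chain column toℕ-column)) ⟩
    (B , write X.D′ cₖ (X.D′ ⟦ rᵢ , cₖ ⟧ - d) d)
      ≡⟨ cong (B ,_) (write-restore D cₖ _ 0ℤ
           (sym (trans (cong (_- d) (write-r D cₖ _ 0ℤ)) (cancel (D ⟦ rᵢ , cₖ ⟧) d))) refl) ⟩
    (B , D) ∎
    where
    open ≡-Reasoning
    module X = Cliffified (cliffified (B , D) dom)
    d = D ⟦ rᵢ₊₁ , cₖ ⟧
    cancel : ∀ x d → x + d - d ≡ x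
    cancel = solve-∀

  -- Going from `B` back to `A`, row i loses `d` units and row i+1 gains them; heights subtract row
  -- sums, so they change by `+ d` and `- d`, as the assignments to h prescribe.
  cliffify-heights : ∀ BD → CliffifyDomain BD → ∀ h → HeightRelations BD h →
                     HeightRelations (proj₁ (cliffify BD h)) (proj₂ (cliffify BD h))
  cliffify-heights (B , D) dom h heights@(hᵢ , hᵢ₊₁) =
    subst (λ BD → HeightRelations BD (proj₂ (cliffify (B , D) h))) (sym (X.computes h heights))
      (atᵢ , atᵢ₊₁)
    where
    open ≡-Reasoning
    module X = Cliffified (cliffified (B , D) dom)
    module I = Invariant (invariant X.chain)
    d = D ⟦ rᵢ₊₁ , cₖ ⟧
    h₁ = h [ rᵢ₊₁ ]≔ (lookup h rᵢ₊₁ - d)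
    h₂ = h₁ [ rᵢ ]≔ (lookup h₁ rᵢ + d)
    lose : ∀ m a d → m - (a + d) + d ≡ m - a
    lose = solve-∀
    gain : ∀ m b d → m - b - d ≡ m - (b + d)
    gain = solve-∀
    atᵢ : lookup h₂ rᵢ ≡ ℤ.+ toℕ rᵢ - rowSum X.A rᵢ k k≤n
    atᵢ = begin
      lookup h₂ rᵢ                                  ≡⟨ lookup∘update rᵢ h₁ _ ⟩
      lookup h₁ rᵢ + d                              ≡⟨ cong (_+ d) (lookup∘update′ rᵢ≢rᵢ₊₁ h _) ⟩
      lookup h rᵢ + d                               ≡⟨ cong (_+ d) hᵢ ⟩
      ℤ.+ toℕ rᵢ - rowSum B rᵢ k k≤n + d            ≡⟨ cong (λ x → ℤ.+ toℕ rᵢ - x + d) (I.sums-r k≤n) ⟩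
      ℤ.+ toℕ rᵢ - (rowSum X.A rᵢ k k≤n + d) + d    ≡⟨ lose (ℤ.+ toℕ rᵢ) (rowSum X.A rᵢ k k≤n) d ⟩
      ℤ.+ toℕ rᵢ - rowSum X.A rᵢ k k≤n              ∎
    atᵢ₊₁ : lookup h₂ rᵢ₊₁ ≡ ℤ.+ toℕ rᵢ₊₁ - rowSum X.A rᵢ₊₁ k k≤n
    atᵢ₊₁ = begin
      lookup h₂ rᵢ₊₁                                ≡⟨ lookup∘update′ (rᵢ≢rᵢ₊₁ ∘ sym) h₁ _ ⟩
      lookup h₁ rᵢ₊₁                                ≡⟨ lookup∘update rᵢ₊₁ h _ ⟩
      lookup h rᵢ₊₁ - d                             ≡⟨ cong (_- d) hᵢ₊₁ ⟩
      ℤ.+ toℕ rᵢ₊₁ - rowSum B rᵢ₊₁ k k≤n - d        ≡⟨ gain (ℤ.+ toℕ rᵢ₊₁) (rowSum B rᵢ₊₁ k k≤n) d ⟩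
      ℤ.+ toℕ rᵢ₊₁ - (rowSum B rᵢ₊₁ k k≤n + d)      ≡⟨ cong (λ x → ℤ.+ toℕ rᵢ₊₁ - x) (I.sums-s k≤n) ⟨
      ℤ.+ toℕ rᵢ₊₁ - rowSum X.A rᵢ₊₁ k k≤n          ∎

  -- The bijection.

  -- The inverse map must depend on the matrices alone, so it needs a canonical choice of h that
  -- meets the relations.
  heightVector : Matrices n → Vec ℤ n
  heightVector (B , _) = tabulate λ q → ℤ.+ toℕ q - rowSum B q k k≤n

  heightVector-heights : ∀ BD → HeightRelations BD (heightVector BD)
  heightVector-heights BD = lookup∘tabulate _ rᵢ , lookup∘tabulate _ rᵢ₊₁

  -- Equality in both setoids compares only the matrices, so membership proofs never have to be
  -- identified.
  untangle-inverse : Inverse (subsetSetoid UntangleDomain) (subsetSetoid CliffifyDomain)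
  untangle-inverse = record
    { to        = λ (BD , dom) → untangle BD , untangle-maps BD dom
    ; from      = λ (BD , dom) → proj₁ (cliffify BD (heightVector BD))
                               , cliffify-maps BD dom (heightVector BD) (heightVector-heights BD)
    ; to-cong   = cong untangle
    ; from-cong = cong λ BD → proj₁ (cliffify BD (heightVector BD))
    ; inverse   = (λ { {BD , dom} refl → untangle-cliffify BD dom (heightVector BD) (heightVector-heights BD) })
                , (λ { {BD , dom} refl → cliffify-untangle BD dom (heightVector (untangle BD)) (heightVector-heights (untangle BD)) })
    }

proposition5p1 : (n i k : ℕ) (k≤i : k ≤ i) (1+i<n : suc i < n) →
    let open Procedures n i k k≤i 1+i<n in
    Σ[ φ ∈ Inverse (subsetSetoid UntangleDomain) (subsetSetoid CliffifyDomain) ]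
    (∀ x → proj₁ (Inverse.to φ x) ≡ untangle (proj₁ x))
    × (∀ y h → HeightRelations (proj₁ y) h →
    proj₁ (Inverse.from φ y) ≡ proj₁ (cliffify (proj₁ y) h)
    × HeightRelations (proj₁ (cliffify (proj₁ y) h)) (proj₂ (cliffify (proj₁ y) h)))
proposition5p1 n i k k≤i 1+i<n =
    untangle-inverse n i k k≤i 1+i<n
  , (λ _ → refl)
  , λ (BD , dom) h heights →
      trans (Cliffified.computes (cliffified n i k k≤i 1+i<n BD dom) (heightVector n i k k≤i 1+i<n BD) (heightVector-heights n i k k≤i 1+i<n BD))
            (sym (Cliffified.computes (cliffified n i k k≤i 1+i<n BD dom) h heights))
    , cliffify-heights n i k k≤i 1+i<n BD dom h heights
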